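{- Let $C_2(n)$ be the number of payphone permutations of type (C2) and size $n$. Then for any integer $n\geq 1$, $$C_2(n) = n\cdot F(S(n-1)),$$ where the function $F$ is defined on the finite multisets $M$ of positive integers by $$F(M) := \bigg(\prod_{k\geq 1} (\#_k M)!\bigg)\cdot 2^{\sum_{k\geq 1} \#_{2k} M}.$$
   Context: Multisets: $\#_k M$ denotes the multiplicity of $k$ in the multiset $M$, and $\cup$ denotes union of multisets with multiplicities added. For $n\ge 0$, the finite multiset $S(n)$ of positive integers is defined recursively by $S(0)=\emptyset$ and $$S(n)=\{n\}\cup S\left(\left\lfloor\tfrac{n-1}{2}\right\rfloor\right)\cup S\left(\left\lceil\tfrac{n-1}{2}\right\rceil\right)\quad (n\ge 1).$$ Type (C2) payphone permutations: $n$ payphones, labeled $1,\dots,n$, are arranged in a circle. Persons $1,2,\dots,n$ come one after another and each occupies an available payphone. The first person takes any payphone. Each subsequent person obeys the following rule. An interval is a maximal sequence of available consecutive payphones; on the circle every interval is closed, i.e., flanked by an occupied payphone on each side (when only one payphone is occupied, the remaining $n-1$ payphones form one closed interval of length $n-1$, flanked on both sides by that payphone). The length of an interval is the number of payphones in it. The person first selects any interval of greatest length and then takes, within it, any payphone whose distance (along the circle) to its closest occupied payphone is as large as possible. The resulting assignment of people to payphones, $(p_1,\dots,p_n)$ with $p_j$ the person occupying payphone $j$, is a payphone permutation of type (C2) and size $n$; $C_2(n)$ counts the distinct permutations of $\{1,\dots,n\}$ that can arise this way. -}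

module Defs where

open import Data.Nat
open import Data.Nat.Properties using (⌊n/2⌋≤n; ⌈n/2⌉≤n)
open import Data.Nat.DivMod using (_mod_)
open import Data.Nat.Induction using (<-rec; <-wellFounded)
open import Data.Nat.ListAction using (sum; product)
open import Data.Fin using (Fin; toℕ)
import Data.Fin as Fin
open import Data.Fin.Properties using (nonZeroIndex)
open import Data.List using (List; []; _∷_; _++_; length; filter; map; foldr; applyUpTo)
open import Data.List.Membership.Propositional using () renaming (_∈_ to _∈ˡ_)
open import Data.List.Membership.Propositional.Properties.WithK using (unique∧set⇒bag)
open import Data.List.Relation.Binary.BagAndSetEquality using (∼bag⇒↭)
open import Data.List.Relation.Binary.Permutation.Propositional.Properties using (↭-length)
open import Data.List.Relation.Unary.Unique.Propositional using (Unique)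
open import Data.Product using (Σ; ∃-syntax; _×_; _,_)
open import Data.Vec using (Vec; lookup)
open import Function using (_⇔_)
open import Function.Properties.Equivalence using (⇔-isEquivalence)
open import Induction.WellFounded using (WfRec; module FixPoint)
open import Level using (0ℓ)
open import Relation.Binary.PropositionalEquality using (_≡_; refl; sym; trans; cong₂)
open import Relation.Binary.Structures using (module IsEquivalence)
open import Relation.Nullary using (¬_)
open import Relation.Unary using (Pred)

-- Finite multisets are lists up to permutation; _++_ adds multiplicities.

Multiset : Set
Multiset = List ℕ

#[_] : ℕ → Multiset → ℕ
#[ k ] M = length (filter (k ≟_) M)

S-step : ∀ n → WfRec _<_ (λ _ → Multiset) n → Multiset
S-step zero    rec = []
S-step (suc m) rec =
  suc m ∷ rec {⌊ m /2⌋} (s≤s (⌊n/2⌋≤n m)) ++ rec {⌈ m /2⌉} (s≤s (⌈n/2⌉≤n m))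

S : ℕ → Multiset
S = <-rec (λ _ → Multiset) S-step

S-zero : S 0 ≡ []
S-zero = refl

S-suc : ∀ m → S (suc m) ≡ suc m ∷ S ⌊ m /2⌋ ++ S ⌈ m /2⌉
S-suc m = unfold-wfRec {suc m}
  where
  step-ext : ∀ n {r r′ : WfRec _<_ (λ _ → Multiset) n} →
             (∀ {k} k<n → r {k} k<n ≡ r′ k<n) → S-step n r ≡ S-step n r′
  step-ext zero    eq = refl
  step-ext (suc m) eq = cong₂ (λ xs ys → suc m ∷ xs ++ ys) (eq _) (eq _)
  open FixPoint <-wellFounded (λ _ → Multiset) S-step step-ext

-- Beyond the largest element every multiplicity is 0, so the product and the
-- sum over all k ≥ 1 may be cut off there.

maximum : Multiset → ℕ
maximum = foldr _⊔_ 0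

F : Multiset → ℕ
F M = product (map (λ k → (#[ k ] M) !) ks) * 2 ^ sum (map (λ k → #[ 2 * k ] M) ks)
  where
  ks : List ℕ
  ks = applyUpTo suc (maximum M)

-- Payphones and persons are both numbered from 0, as elements of Fin n.

infixl 6 _⊕_

_⊕_ : ∀ {n} → Fin n → ℕ → Fin n
_⊕_ {n} j k = (toℕ j + k) mod n
  where instance _ = nonZeroIndex j

circularDistance : ∀ {n} → Fin n → Fin n → ℕ
circularDistance {n} i j = d ⊓ (n ∸ d)
  where
  d : ℕ
  d = ∣ toℕ i - toℕ j ∣

-- The interval flank ⊕ 1 , … , flank ⊕ size.  It is maximal because the
-- payphones flank and flank ⊕ (size + 1), which may coincide, are occupied.

record Interval {n} (Occupied : Pred (Fin n) 0ℓ) : Set where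
  field
    flank     : Fin n
    size      : ℕ
    nonempty  : 1 ≤ size
    occupiedˡ : Occupied flank
    available : ∀ i → i < size → ¬ Occupied (flank ⊕ suc i)
    occupiedʳ : Occupied (flank ⊕ suc size)

open Interval public using (flank; size)

infix 4 _∈ᴵ_

_∈ᴵ_ : ∀ {n} {Occupied : Pred (Fin n) 0ℓ} → Fin n → Interval Occupied → Set
j ∈ᴵ I = ∃[ i ] (i < size I × flank I ⊕ suc i ≡ j)

DistanceToClosest : ∀ {n} → Pred (Fin n) 0ℓ → Fin n → ℕ → Set
DistanceToClosest Occupied j d =
  (∃[ o ] (Occupied o × circularDistance j o ≡ d)) ×
  (∀ o → Occupied o → d ≤ circularDistance j o)

Longest : ∀ {n} {Occupied : Pred (Fin n) 0ℓ} → Interval Occupied → Set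
Longest {Occupied = Occupied} I = ∀ (I′ : Interval Occupied) → size I′ ≤ size I

FarthestIn : ∀ {n} {Occupied : Pred (Fin n) 0ℓ} → Interval Occupied → Fin n → Set
FarthestIn {Occupied = Occupied} I j =
  ∀ j′ → j′ ∈ᴵ I → ∀ d d′ →
  DistanceToClosest Occupied j d → DistanceToClosest Occupied j′ d′ → d′ ≤ d

AllowedC₂ : ∀ {n} → Pred (Fin n) 0ℓ → Fin n → Set
AllowedC₂ Occupied j =
  Σ (Interval Occupied) λ I → Longest I × j ∈ᴵ I × FarthestIn I j

-- A seating sends each person to the payphone that this person occupies.

OccupiedBefore : ∀ {n} → (Fin n → Fin n) → Fin n → Pred (Fin n) 0ℓ
OccupiedBefore seat person j = ∃[ earlier ] (earlier Fin.< person × seat earlier ≡ j)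

FollowsC₂ : ∀ {n} → (Fin n → Fin n) → Set
FollowsC₂ seat =
  ∀ person → 1 ≤ toℕ person → AllowedC₂ (OccupiedBefore seat person) (seat person)

-- lookup p j is the person at payphone j.  Members of an interval are
-- available, so seat is injective and p is a permutation.

PayphonePermutationC₂ : ∀ n → Pred (Vec (Fin n) n) 0ℓ
PayphonePermutationC₂ n p =
  ∃[ seat ] (FollowsC₂ seat × (∀ person → lookup p (seat person) ≡ person))

HasCardinality : ∀ {A : Set} → Pred A 0ℓ → ℕ → Set
HasCardinality P c =
  ∃[ xs ] (Unique xs × (∀ x → x ∈ˡ xs ⇔ P x) × length xs ≡ c)

HasCardinality-unique : ∀ {A : Set} {P : Pred A 0ℓ} {c d} →
                        HasCardinality P c → HasCardinality P d → c ≡ d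
HasCardinality-unique (xs , xs! , xs⇔P , xs-len) (ys , ys! , ys⇔P , ys-len) =
  trans (sym xs-len) (trans (↭-length (∼bag⇒↭ xs∼ys)) ys-len)
  where
  module ⇔ = IsEquivalence ⇔-isEquivalence
  xs∼ys = unique∧set⇒bag xs! ys! (λ {x} → ⇔.trans (xs⇔P x) (⇔.sym (ys⇔P x)))

-- C₂(n) as a relation: the number of payphone permutations of size n is c.

infix 4 C₂[_]≡_

C₂[_]≡_ : ℕ → ℕ → Set
C₂[ n ]≡ c = HasCardinality (PayphonePermutationC₂ n) c

{-# OPTIONS --safe #-}
module Submission where

open import Defs
open import Data.Bool using (true; false)
open import Data.Fin using (Fin; toℕ)
import Data.Fin as Fin
import Data.Fin.Properties as Fin
open import Data.List using (List; []; _∷_; _++_; length; map; filter; applyUpTo; allFin; concatMap)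
open import Data.List.Membership.Propositional using (_∈_)
open import Data.List.Membership.Propositional.Properties
  using (∈-map⁺; ∈-map⁻; ∈-++⁺ˡ; ∈-++⁺ʳ; ∈-++⁻; ∈-filter⁺; ∈-filter⁻; ∈-applyUpTo⁺; ∈-allFin; ∈-∃++)
open import Data.List.Properties
  using (map-++; map-cong; map-cong-local; applyUpTo-∷ʳ; filter-accept; filter-reject; filter-none;
         filter-++; length-++; length-map; length-tabulate; ++-assoc; ++-identityʳ)
open import Data.List.Relation.Binary.Permutation.Propositional
  using (_↭_; ↭-sym; ↭-trans; ↭-reflexive; ↭⇒↭ₛ)
import Data.List.Relation.Binary.Permutation.Propositional as ↭
import Data.List.Relation.Binary.Permutation.Propositional.Properties as ↭
open import Data.List.Relation.Binary.Permutation.Setoid.Properties using (Unique-resp-↭)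
open import Data.List.Relation.Unary.All as All using (All; []; _∷_)
import Data.List.Relation.Unary.All.Properties as All
open import Data.List.Relation.Unary.AllPairs using ([]; _∷_)
open import Data.List.Relation.Unary.Any using (here; there)
open import Data.List.Relation.Unary.Unique.Propositional using (Unique)
import Data.List.Relation.Unary.Unique.Propositional.Properties as Unique
open import Data.Nat
open import Data.Nat.DivMod
open import Data.Nat.Induction using (<-rec)
open import Data.Nat.ListAction using (sum; product)
open import Data.Nat.ListAction.Properties using (sum-++; product-++)
open import Data.Nat.Properties
open import Data.Nat.Tactic.RingSolver using (solve-∀)
open import Data.Product using (∃-syntax; _×_; _,_; proj₁; proj₂; uncurry)
open import Data.Sum as Sum using (_⊎_; inj₁; inj₂; [_,_])
open import Data.Unit using (⊤; tt)
open import Data.Vec using (Vec; []; _∷_; lookup; tabulate)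
open import Data.Vec.Properties using (lookup∘tabulate; tabulate∘lookup; tabulate-cong)
open import Function using (_∘_; _$_; const; id; mk⇔; Equivalence)
open import Function.Definitions using (Injective)
open import Level using (0ℓ)
open import Relation.Binary.Definitions using (tri<; tri≈; tri>)
open import Relation.Binary.PropositionalEquality
  using (_≡_; _≢_; refl; sym; trans; cong; cong₂; subst; subst₂; setoid; ≢-sym; module ≡-Reasoning)
open import Relation.Nullary using (¬_; Dec; yes; no; contradiction)
open import Relation.Unary using (Pred; _⊆_)

open Equivalence using (to; from)

-- A state of the process is the list of gaps between consecutive occupied
-- payphones.  Seating a person replaces one longest gap, of size m + 1, by gaps of
-- sizes ⌊m/2⌋ and ⌈m/2⌉, so the multiset total G, the union of S over the gap
-- sizes, loses exactly one element m + 1, whatever the choice.  The number of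
-- choices is the multiplicity of m + 1 in total G, times 2 when m + 1 is even (two
-- farthest payphones), and this is also the ratio F (total G) / F (total G′) for
-- the next state G′.  Hence F (total G) counts the ways to seat the remaining persons.

-- The successors of a state are different gap lists, and no bijection between their continuations
-- is at hand. None is needed: all successors have the same total up to permutation, and the number
-- of continuations is proved to depend on the total alone. The number of longest gaps remains
-- visible there, because for positive `s` the multiset `S s` contains `s` once and otherwise only
-- smaller numbers. As `S s` has `s` elements, the length of the total is the number of persons
-- still to come, which drives the induction. Gaps of size 0 stay in the list: they add nothing to
-- the total, but with them gaps correspond one to one to occupied payphones. A permutation is the
-- inverse of its seating, so seatings are counted instead; the free choice of the first person
-- gives the factor `n`.

-- Multiplicities, and the effect on `F` of one more element.

#-≡ : ∀ k M → #[ k ] (k ∷ M) ≡ suc (#[ k ] M)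
#-≡ k M = cong length (filter-accept (k ≟_) refl)

#-≢ : ∀ {j k} M → j ≢ k → #[ j ] (k ∷ M) ≡ #[ j ] M
#-≢ {j} M j≢k = cong length (filter-reject (j ≟_) j≢k)

#-++ : ∀ k M N → #[ k ] (M ++ N) ≡ #[ k ] M + #[ k ] N
#-++ k M N = trans (cong length (filter-++ (k ≟_) M N)) (length-++ (filter (k ≟_) M))

#-< : ∀ {k M} → All (_< k) M → #[ k ] M ≡ 0
#-< {k} M<k = cong length (filter-none (k ≟_) (All.map (≢-sym ∘ <⇒≢) M<k))

#-↭ : ∀ {M N} → M ↭ N → ∀ k → #[ k ] M ≡ #[ k ] N
#-↭ M↭N k = ↭.↭-length (↭.filter-↭ (k ≟_) M↭N)

≤-maximum : ∀ M → All (_≤ maximum M) M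
≤-maximum []      = []
≤-maximum (x ∷ M) =
  m≤m⊔n x (maximum M) ∷ All.map (λ y≤ → ≤-trans y≤ (m≤n⊔m x (maximum M))) (≤-maximum M)

#-maximum : ∀ M {k} → maximum M < k → #[ k ] M ≡ 0
#-maximum M max<k = #-< (All.map (λ x≤ → <-≤-trans (s≤s x≤) max<k) (≤-maximum M))

map-applyUpTo-suc : ∀ (f : ℕ → ℕ) N →
                    map f (applyUpTo suc (suc N)) ≡ map f (applyUpTo suc N) ++ (f (suc N) ∷ [])
map-applyUpTo-suc f N =
  trans (cong (map f) (sym (applyUpTo-∷ʳ suc N))) (map-++ f (applyUpTo suc N) (suc N ∷ []))

-- `F` is cut off at the maximum of its own argument, so two multisets can be compared only after
-- both cutoffs are raised to a common bound.
product-extend : ∀ (f : ℕ → ℕ) {N N′} → N ≤′ N′ → (∀ {k} → N < k → f k ≡ 1) →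
                 product (map f (applyUpTo suc N)) ≡ product (map f (applyUpTo suc N′))
product-extend f ≤′-refl                f≡1 = refl
product-extend f {N} (≤′-step {N′} N≤N′) f≡1 = begin
  product (map f (applyUpTo suc N))                      ≡⟨ product-extend f N≤N′ f≡1 ⟩
  product (map f (applyUpTo suc N′))                     ≡⟨ *-identityʳ _ ⟨
  product (map f (applyUpTo suc N′)) * 1                 ≡⟨ cong (product (map f (applyUpTo suc N′)) *_) last≡1 ⟨
  product (map f (applyUpTo suc N′)) * (f (suc N′) * 1)  ≡⟨ product-++ (map f (applyUpTo suc N′)) (f (suc N′) ∷ []) ⟨
  product (map f (applyUpTo suc N′) ++ f (suc N′) ∷ [])  ≡⟨ cong product (map-applyUpTo-suc f N′) ⟨
  product (map f (applyUpTo suc (suc N′)))               ∎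
  where
  open ≡-Reasoning
  last≡1 : f (suc N′) * 1 ≡ 1
  last≡1 = trans (*-identityʳ _) (f≡1 (s≤s (≤′⇒≤ N≤N′)))

sum-extend : ∀ (f : ℕ → ℕ) {N N′} → N ≤′ N′ → (∀ {k} → N < k → f k ≡ 0) →
             sum (map f (applyUpTo suc N)) ≡ sum (map f (applyUpTo suc N′))
sum-extend f ≤′-refl                f≡0 = refl
sum-extend f {N} (≤′-step {N′} N≤N′) f≡0 = begin
  sum (map f (applyUpTo suc N))                      ≡⟨ sum-extend f N≤N′ f≡0 ⟩
  sum (map f (applyUpTo suc N′))                     ≡⟨ +-identityʳ _ ⟨
  sum (map f (applyUpTo suc N′)) + 0                 ≡⟨ cong (sum (map f (applyUpTo suc N′)) +_) last≡0 ⟨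
  sum (map f (applyUpTo suc N′)) + (f (suc N′) + 0)  ≡⟨ sum-++ (map f (applyUpTo suc N′)) (f (suc N′) ∷ []) ⟨
  sum (map f (applyUpTo suc N′) ++ f (suc N′) ∷ [])  ≡⟨ cong sum (map-applyUpTo-suc f N′) ⟨
  sum (map f (applyUpTo suc (suc N′)))               ∎
  where
  open ≡-Reasoning
  last≡0 : f (suc N′) + 0 ≡ 0
  last≡0 = trans (+-identityʳ _) (f≡0 (s≤s (≤′⇒≤ N≤N′)))

-- Uniqueness of `ks` makes `k` occur once, so the factor `c` is picked up once.
product-bump : ∀ {f g : ℕ → ℕ} {k ks} c → Unique ks → k ∈ ks →
               (∀ {j} → j ≢ k → f j ≡ g j) → f k ≡ c * g k →
               product (map f ks) ≡ c * product (map g ks)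
product-bump {f} {g} {k} {_ ∷ ks} c (k∉ ∷ _) (here refl) f≡g fk = begin
  f k * product (map f ks)        ≡⟨ cong₂ _*_ fk (cong product (map-cong-local (All.map (f≡g ∘ ≢-sym) k∉))) ⟩
  c * g k * product (map g ks)    ≡⟨ *-assoc c _ _ ⟩
  c * (g k * product (map g ks))  ∎
  where open ≡-Reasoning
product-bump {f} {g} {k} {j ∷ ks} c (j∉ ∷ ks!) (there k∈ks) f≡g fk = begin
  f j * product (map f ks)        ≡⟨ cong₂ _*_ (f≡g (All.lookup j∉ k∈ks)) (product-bump c ks! k∈ks f≡g fk) ⟩
  g j * (c * product (map g ks))  ≡⟨ swap-front (g j) c _ ⟩
  c * (g j * product (map g ks))  ∎
  where
  open ≡-Reasoning
  swap-front : ∀ x y z → x * (y * z) ≡ y * (x * z)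
  swap-front = solve-∀

sum-bump : ∀ {f g : ℕ → ℕ} {k ks} → Unique ks → k ∈ ks →
           (∀ {j} → j ≢ k → f j ≡ g j) → f k ≡ suc (g k) →
           sum (map f ks) ≡ suc (sum (map g ks))
sum-bump {f} {g} {k} {ks = _ ∷ ks} (k∉ ∷ _) (here refl) f≡g fk =
  cong₂ _+_ fk (cong sum (map-cong-local (All.map (f≡g ∘ ≢-sym) k∉)))
sum-bump {f} {g} {k} {ks = j ∷ ks} (j∉ ∷ ks!) (there k∈ks) f≡g fk =
  trans (cong₂ _+_ (f≡g (All.lookup j∉ k∈ks)) (sum-bump ks! k∈ks f≡g fk)) (+-suc (g j) _)

factorialsUpTo : ℕ → Multiset → ℕ
factorialsUpTo N M = product (map (λ k → (#[ k ] M) !) (applyUpTo suc N))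

evensUpTo : ℕ → Multiset → ℕ
evensUpTo N M = sum (map (λ k → #[ 2 * k ] M) (applyUpTo suc N))

F-cutoff : ∀ {N} M → maximum M ≤ N → F M ≡ factorialsUpTo N M * 2 ^ evensUpTo N M
F-cutoff M max≤N = cong₂ (λ p s → p * 2 ^ s)
  (product-extend _ (≤⇒≤′ max≤N) (λ max<k → cong _! (#-maximum M max<k)))
  -- The same cutoff serves the even multiplicities, because `k ≤ 2 * k`.
  (sum-extend _ (≤⇒≤′ max≤N) (λ max<k → #-maximum M (<-≤-trans max<k (m≤n*m _ 2))))

F-↭ : ∀ {M N} → M ↭ N → F M ≡ F N
F-↭ {M} {N} M↭N = begin
  F M                                     ≡⟨ F-cutoff M (m≤m⊔n (maximum M) (maximum N)) ⟩
  factorialsUpTo b M * 2 ^ evensUpTo b M  ≡⟨ cong₂ (λ p s → p * 2 ^ s)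
    (cong product (map-cong (λ k → cong _! (#-↭ M↭N k)) (applyUpTo suc b)))
    (cong sum (map-cong (λ k → #-↭ M↭N (2 * k)) (applyUpTo suc b))) ⟩
  factorialsUpTo b N * 2 ^ evensUpTo b N  ≡⟨ F-cutoff N (m≤n⊔m (maximum M) (maximum N)) ⟨
  F N                                     ∎
  where
  open ≡-Reasoning
  b = maximum M ⊔ maximum N

range! : ∀ N → Unique (applyUpTo suc N)
range! N = Unique.applyUpTo⁺₁ suc N (λ i<j _ → <⇒≢ (s≤s i<j))

factorials-∷ : ∀ {m N} M → m < N →
               factorialsUpTo N (suc m ∷ M) ≡ suc (#[ suc m ] M) * factorialsUpTo N M
factorials-∷ {m} {N} M m<N =
  product-bump (suc (#[ suc m ] M)) (range! N) (∈-applyUpTo⁺ suc m<N)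
    (λ j≢ → cong _! (#-≢ M j≢)) (cong _! (#-≡ (suc m) M))

-- The factorials grow in the same way for either parity of `suc m`; parity enters only through `c`,
-- the growth of the power of two.
F-∷ : ∀ m c M → let N = maximum (suc m ∷ M) in
      2 ^ evensUpTo N (suc m ∷ M) ≡ c * 2 ^ evensUpTo N M →
      F (suc m ∷ M) ≡ suc (#[ suc m ] M) * c * F M
F-∷ m c M evens = begin
  factorialsUpTo N (k ∷ M) * 2 ^ evensUpTo N (k ∷ M)
    ≡⟨ cong₂ _*_ (factorials-∷ M (m≤m⊔n k (maximum M))) evens ⟩
  u * factorialsUpTo N M * (c * 2 ^ evensUpTo N M)
    ≡⟨ regroup u (factorialsUpTo N M) c _ ⟩
  u * c * (factorialsUpTo N M * 2 ^ evensUpTo N M)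
    ≡⟨ cong (u * c *_) (F-cutoff M (m≤n⊔m k (maximum M))) ⟨
  u * c * F M
    ∎
  where
  open ≡-Reasoning
  k = suc m
  u = suc (#[ k ] M)
  N = maximum (k ∷ M)
  regroup : ∀ u p c e → u * p * (c * e) ≡ u * c * (p * e)
  regroup = solve-∀

F-∷-odd : ∀ h M → F (suc (h + h) ∷ M) ≡ suc (#[ suc (h + h) ] M) * 1 * F M
F-∷-odd h M = F-∷ (h + h) 1 M
  (trans (cong (λ ms → 2 ^ sum ms) (map-cong (λ j → #-≢ M (2*≢ j)) (applyUpTo suc N)))
         (sym (*-identityˡ _)))
  where
  N = maximum (suc (h + h) ∷ M)
  2*≢ : ∀ j → 2 * j ≢ suc (h + h)
  2*≢ j eq = even≢odd j h (trans eq (cong (λ x → suc (h + x)) (sym (+-identityʳ h))))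

F-∷-even : ∀ h M → F (suc (suc (h + h)) ∷ M) ≡ suc (#[ suc (suc (h + h)) ] M) * 2 * F M
F-∷-even h M = F-∷ (suc (h + h)) 2 M
  -- The new element is `2 * suc h`, so only the summand at `suc h` grows.
  (cong (2 ^_) (sum-bump (range! N) (∈-applyUpTo⁺ suc h<N) (λ j≢ → #-≢ M (2*≢ j≢))
    (subst (λ x → #[ x ] (k ∷ M) ≡ suc (#[ x ] M)) (sym (double h)) (#-≡ k M))))
  where
  k = suc (suc (h + h))
  N = maximum (k ∷ M)
  double : ∀ h → 2 * suc h ≡ suc (suc (h + h))
  double = solve-∀
  h<N : h < N
  h<N = ≤-trans (s≤s (m≤n⇒m≤1+n (m≤m+n h h))) (m≤m⊔n k (maximum M))
  2*≢ : ∀ {j} → j ≢ suc h → 2 * j ≢ k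
  2*≢ j≢ eq = j≢ (*-cancelˡ-≡ _ _ 2 (trans eq (sym (double h))))

-- The multiset `S` and its middle splits.

All-S : ∀ n → All (_≤ n) (S n)
All-S = <-rec _ λ where
  zero    _   → []
  (suc m) rec → subst (All (_≤ suc m)) (sym (S-suc m)) $
    ≤-refl ∷ All.++⁺
      (All.map (λ x≤ → ≤-trans x≤ (m≤n⇒m≤1+n (⌊n/2⌋≤n m))) (rec (s≤s (⌊n/2⌋≤n m))))
      (All.map (λ x≤ → ≤-trans x≤ (m≤n⇒m≤1+n (⌈n/2⌉≤n m))) (rec (s≤s (⌈n/2⌉≤n m))))

length-S : ∀ n → length (S n) ≡ n
length-S = <-rec _ λ where
  zero    _   → refl
  (suc m) rec → trans (cong length (S-suc m)) (cong suc (trans (length-++ (S ⌊ m /2⌋))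
    (trans (cong₂ _+_ (rec (s≤s (⌊n/2⌋≤n m))) (rec (s≤s (⌈n/2⌉≤n m)))) (⌊n/2⌋+⌈n/2⌉≡n m))))

#-S : ∀ m → #[ suc m ] (S (suc m)) ≡ 1
#-S m = trans (cong #[ suc m ] (S-suc m)) (trans (#-≡ (suc m) (S ⌊ m /2⌋ ++ S ⌈ m /2⌉))
  (cong suc (#-< (All.++⁺
    (All.map (λ x≤ → s≤s (≤-trans x≤ (⌊n/2⌋≤n m))) (All-S ⌊ m /2⌋))
    (All.map (λ x≤ → s≤s (≤-trans x≤ (⌈n/2⌉≤n m))) (All-S ⌈ m /2⌉))))))

-- A size equal to `suc m` contributes its own value once, and a smaller size contributes only
-- smaller values. Thus the longest gaps can be counted in the total.
#-concatMap-S : ∀ m {ss} → All (_≤ suc m) ss → #[ suc m ] (concatMap S ss) ≡ #[ suc m ] ss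
#-concatMap-S m []                   = refl
#-concatMap-S m {s ∷ ss} (s≤ ∷ ss≤) = trans (#-++ (suc m) (S s) _) (head (suc m ≟ s))
  where
  head : Dec (suc m ≡ s) → #[ suc m ] (S s) + #[ suc m ] (concatMap S ss) ≡ #[ suc m ] (s ∷ ss)
  head (yes refl) = trans (cong₂ _+_ (#-S m) (#-concatMap-S m ss≤)) (sym (#-≡ (suc m) ss))
  head (no  m≢s)  = trans
    (cong₂ _+_ (#-< (All.map (λ x≤ → <-≤-trans (s≤s x≤) (≤∧≢⇒< s≤ (≢-sym m≢s))) (All-S s)))
               (#-concatMap-S m ss≤))
    (sym (#-≢ ss m≢s))

Middle : ℕ → ℕ → Set
Middle m i = i ≡ ⌊ m /2⌋ ⊎ i ≡ ⌈ m /2⌉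

Middle-≤ : ∀ {m i} → Middle m i → i ≤ m
Middle-≤ (inj₁ refl) = ⌊n/2⌋≤n _
Middle-≤ (inj₂ refl) = ⌈n/2⌉≤n _

-- The complement of one half is the other half. For `⌈ m /2⌉` the halves appear in the opposite
-- order, hence a permutation and not an equality.
S-split : ∀ {m i} → Middle m i → S (suc m) ↭ suc m ∷ S i ++ S (m ∸ i)
S-split {m} (inj₁ refl) = ↭-reflexive (trans (S-suc m) (cong (λ x → suc m ∷ S ⌊ m /2⌋ ++ S x)
  (trans (sym (m+n∸m≡n ⌊ m /2⌋ _)) (cong (_∸ ⌊ m /2⌋) (⌊n/2⌋+⌈n/2⌉≡n m)))))
S-split {m} (inj₂ refl) = ↭-trans (↭-reflexive (S-suc m)) (↭.prep _ (↭-trans (↭.++-comm (S ⌊ m /2⌋) _)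
  (↭-reflexive (cong (λ x → S ⌈ m /2⌉ ++ S x)
  (trans (sym (m+n∸n≡m ⌊ m /2⌋ ⌈ m /2⌉)) (cong (_∸ ⌈ m /2⌉) (⌊n/2⌋+⌈n/2⌉≡n m)))))))

halve : ∀ m → ∃[ h ] (m ≡ h + h ⊎ m ≡ suc (h + h))
halve zero    = 0 , inj₁ refl
halve (suc m) with halve m
... | h , inj₁ refl = h , inj₂ refl
... | h , inj₂ refl = suc h , inj₁ (cong suc (sym (+-suc h h)))

-- Walks and distances on the circle.

toℕ-⊕ : ∀ {n} .{{_ : NonZero n}} (j : Fin n) k → toℕ (j ⊕ k) ≡ (toℕ j + k) % n
toℕ-⊕ j k = Fin.toℕ-fromℕ< _

⊕-assoc : ∀ {n} (j : Fin n) k l → j ⊕ k ⊕ l ≡ j ⊕ (k + l)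
⊕-assoc {suc n-1} j k l = Fin.toℕ-injective $ begin
  toℕ (j ⊕ k ⊕ l)                ≡⟨ toℕ-⊕ (j ⊕ k) l ⟩
  (toℕ (j ⊕ k) + l) % n          ≡⟨ cong (λ x → (x + l) % n) (toℕ-⊕ j k) ⟩
  ((toℕ j + k) % n + l) % n      ≡⟨ %-distribˡ-+ ((toℕ j + k) % n) l n ⟩
  ((toℕ j + k) % n % n + l % n) % n
                                 ≡⟨ cong (λ x → (x + l % n) % n) (m%n%n≡m%n (toℕ j + k) n) ⟩
  ((toℕ j + k) % n + l % n) % n  ≡⟨ %-distribˡ-+ (toℕ j + k) l n ⟨
  (toℕ j + k + l) % n            ≡⟨ cong (_% n) (+-assoc (toℕ j) k l) ⟩
  (toℕ j + (k + l)) % n          ≡⟨ toℕ-⊕ j (k + l) ⟨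
  toℕ (j ⊕ (k + l))              ∎
  where
  open ≡-Reasoning
  n = suc n-1

⊕-multiple : ∀ {n} (j : Fin n) q → j ⊕ q * n ≡ j
⊕-multiple {suc n-1} j q = Fin.toℕ-injective $
  trans (toℕ-⊕ j (q * suc n-1))
    (trans ([m+kn]%n≡m%n (toℕ j) q (suc n-1)) (m<n⇒m%n≡m (Fin.toℕ<n j)))

⊕-cycle : ∀ {n} (j : Fin n) → j ⊕ n ≡ j
⊕-cycle {n} j = trans (cong (j ⊕_) (sym (*-identityˡ n))) (⊕-multiple j 1)

⊕-cancel : ∀ {n} {j j′ : Fin n} k → j ⊕ k ≡ j′ ⊕ k → j ≡ j′
⊕-cancel {suc n-1} {j} {j′} k eq = begin
  j                          ≡⟨ undo j ⟨
  j ⊕ k ⊕ k * n-1            ≡⟨ cong (_⊕ k * n-1) eq ⟩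
  j′ ⊕ k ⊕ k * n-1           ≡⟨ undo j′ ⟩
  j′                         ∎
  where
  open ≡-Reasoning
  -- After `k` steps, `k * n-1` more complete `k` full turns.
  undo : ∀ i → i ⊕ k ⊕ k * n-1 ≡ i
  undo i = trans (⊕-assoc i k (k * n-1))
    (trans (cong (i ⊕_) (sym (*-suc k n-1))) (⊕-multiple i k))

-- This turns a walk into an equation over ℕ; `q` counts the passages from the last payphone to
-- payphone 0.
⊕-quotient : ∀ {n} (j : Fin n) k → ∃[ q ] (toℕ j + k ≡ toℕ (j ⊕ k) + q * n)
⊕-quotient {n@(suc _)} j k = (toℕ j + k) / n ,
  trans (m≡m%n+[m/n]*n (toℕ j + k) n) (cong (_+ (toℕ j + k) / n * n) (sym (toℕ-⊕ j k)))

⊕-fixed : ∀ {n} (j : Fin n) {k} → k < n → j ⊕ k ≡ j → k ≡ 0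
⊕-fixed {n} j {k} k<n eq with ⊕-quotient j k
... | q , eq′ with q | +-cancelˡ-≡ (toℕ j) _ _ (trans eq′ (cong (λ i → toℕ i + q * n) eq))
... | zero  | k≡0 = k≡0
... | suc q | k≡  = contradiction (≤-trans (m≤m+n n (q * n)) (≤-reflexive (sym k≡))) (<⇒≱ k<n)

circularDistance-sym : ∀ {n} (i j : Fin n) → circularDistance i j ≡ circularDistance j i
circularDistance-sym {n} i j = cong (λ d → d ⊓ (n ∸ d)) (∣-∣-comm (toℕ i) (toℕ j))

-- The distance is the minimum of two arcs, so bounding one suffices: the complementary arc if the
-- walk wraps around and ends at or before `toℕ j`, the direct arc otherwise.
circularDistance-⊕ : ∀ {n} (j : Fin n) k → circularDistance j (j ⊕ k) ≤ k
circularDistance-⊕ {n} j k with ⊕-quotient j k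
... | zero , eq = begin
  circularDistance j (j ⊕ k)  ≤⟨ m⊓n≤m _ _ ⟩
  ∣ a - b ∣                   ≡⟨ cong (∣ a -_∣) (trans (sym (+-identityʳ b)) (sym eq)) ⟩
  ∣ a - (a + k) ∣             ≡⟨ ∣m-m+n∣≡n a k ⟩
  k                           ∎
  where
  open ≤-Reasoning
  a = toℕ j
  b = toℕ (j ⊕ k)
... | suc q , eq with ≤-total (toℕ j) (toℕ (j ⊕ k))
...   | inj₁ a≤b = begin
  circularDistance j (j ⊕ k)  ≤⟨ m⊓n≤m _ _ ⟩
  ∣ a - b ∣                   ≡⟨ m≤n⇒∣m-n∣≡n∸m a≤b ⟩
  b ∸ a                       ≤⟨ ∸-monoˡ-≤ a (≤-trans (m≤m+n b _) (≤-reflexive (sym eq))) ⟩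
  a + k ∸ a                   ≡⟨ m+n∸m≡n a k ⟩
  k                           ∎
  where
  open ≤-Reasoning
  a = toℕ j
  b = toℕ (j ⊕ k)
...   | inj₂ b≤a = begin
  circularDistance j (j ⊕ k)  ≤⟨ m⊓n≤n ∣ a - b ∣ _ ⟩
  n ∸ ∣ a - b ∣               ≡⟨ cong (n ∸_) (m≤n⇒∣n-m∣≡n∸m b≤a) ⟩
  n ∸ (a ∸ b)                 ≤⟨ m≤n+o⇒m∸n≤o n (a ∸ b) (+-cancelˡ-≤ b n _ b+n≤) ⟩
  k                           ∎
  where
  open ≤-Reasoning
  a = toℕ j
  b = toℕ (j ⊕ k)
  b+n≤ : b + n ≤ b + (a ∸ b + k)
  b+n≤ = begin
    b + n            ≤⟨ +-monoʳ-≤ b (m≤m+n n (q * n)) ⟩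
    b + suc q * n    ≡⟨ eq ⟨
    a + k            ≡⟨ cong (_+ k) (m+[n∸m]≡n b≤a) ⟨
    b + (a ∸ b) + k  ≡⟨ +-assoc b (a ∸ b) k ⟩
    b + (a ∸ b + k)  ∎

⊕-difference : ∀ {n} {i j : Fin n} → toℕ i ≤ toℕ j → i ⊕ (toℕ j ∸ toℕ i) ≡ j
⊕-difference {suc _} {i} {j} i≤j = Fin.toℕ-injective $ trans (toℕ-⊕ i _)
  (trans (cong (_% _) (m+[n∸m]≡n i≤j)) (m<n⇒m%n≡m (Fin.toℕ<n j)))

circularDistance-reached-≤ : ∀ {n} {i j : Fin n} → toℕ i ≤ toℕ j → let d = circularDistance i j in
                             i ⊕ d ≡ j ⊎ j ⊕ d ≡ i
circularDistance-reached-≤ {n} {i} {j} i≤j with ⊓-sel ∣ toℕ i - toℕ j ∣ (n ∸ ∣ toℕ i - toℕ j ∣)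
... | inj₁ d≡ = inj₁ (trans (cong (i ⊕_) (trans d≡ (m≤n⇒∣m-n∣≡n∸m i≤j))) (⊕-difference i≤j))
... | inj₂ d≡ = inj₂ (begin
  j ⊕ circularDistance i j  ≡⟨ cong (j ⊕_) (trans d≡ (cong (n ∸_) (m≤n⇒∣m-n∣≡n∸m i≤j))) ⟩
  j ⊕ (n ∸ δ)               ≡⟨ cong (_⊕ (n ∸ δ)) (⊕-difference i≤j) ⟨
  i ⊕ δ ⊕ (n ∸ δ)           ≡⟨ ⊕-assoc i δ (n ∸ δ) ⟩
  i ⊕ (δ + (n ∸ δ))         ≡⟨ cong (i ⊕_) (m+[n∸m]≡n (≤-trans (m∸n≤m _ (toℕ i)) (<⇒≤ (Fin.toℕ<n j)))) ⟩
  i ⊕ n                     ≡⟨ ⊕-cycle i ⟩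
  i                         ∎)
  where
  open ≡-Reasoning
  δ = toℕ j ∸ toℕ i

-- The shorter arc is itself a walk, in one direction or the other. With `circularDistance-⊕`, later
-- arguments about distance become arguments about walks.
circularDistance-reached : ∀ {n} (i j : Fin n) → let d = circularDistance i j in
                           i ⊕ d ≡ j ⊎ j ⊕ d ≡ i
circularDistance-reached i j with ≤-total (toℕ i) (toℕ j)
... | inj₁ i≤j = circularDistance-reached-≤ i≤j
... | inj₂ j≤i = subst (λ d → i ⊕ d ≡ j ⊎ j ⊕ d ≡ i) (circularDistance-sym j i)
                       (Sum.swap (circularDistance-reached-≤ j≤i))

-- Rules for counting.

HasCardinality-⇔ : ∀ {A : Set} {P Q : Pred A 0ℓ} {c} → P ⊆ Q → Q ⊆ P →
                   HasCardinality P c → HasCardinality Q c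
HasCardinality-⇔ P⊆Q Q⊆P (xs , xs! , xs⇔P , len) =
  xs , xs! , (λ x → mk⇔ (P⊆Q ∘ to (xs⇔P x)) (from (xs⇔P x) ∘ Q⊆P)) , len

HasCardinality-⊎ : ∀ {A : Set} {P Q : Pred A 0ℓ} {c d} → (∀ {x} → P x → ¬ Q x) →
                   HasCardinality P c → HasCardinality Q d → HasCardinality (λ x → P x ⊎ Q x) (c + d)
HasCardinality-⊎ disjoint (xs , xs! , xs⇔P , refl) (ys , ys! , ys⇔Q , refl) =
  xs ++ ys ,
  Unique.++⁺ xs! ys! (λ (z∈xs , z∈ys) → disjoint (to (xs⇔P _) z∈xs) (to (ys⇔Q _) z∈ys)) ,
  (λ x → mk⇔ ([ inj₁ ∘ to (xs⇔P x) , inj₂ ∘ to (ys⇔Q x) ] ∘ ∈-++⁻ xs)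
             [ ∈-++⁺ˡ ∘ from (xs⇔P x) , ∈-++⁺ʳ xs ∘ from (ys⇔Q x) ]) ,
  length-++ xs

-- Injectivity is asked on members only, since `position` and `permutation` are injective only on
-- valid choices and seatings.
map-unique : ∀ {A B : Set} (f : A → B) {xs} →
             (∀ {x y} → x ∈ xs → y ∈ xs → f x ≡ f y → x ≡ y) → Unique xs → Unique (map f xs)
map-unique f inj []          = []
map-unique f inj (x∉ ∷ xs!) =
  All.tabulate (λ y∈ fx≡y → let z , z∈xs , y≡fz = ∈-map⁻ f y∈ in
    All.lookup x∉ z∈xs (inj (here refl) (there z∈xs) (trans fx≡y y≡fz)))
  ∷ map-unique f (λ x∈ y∈ → inj (there x∈) (there y∈)) xs!

HasCardinality-image : ∀ {A B : Set} {P : Pred A 0ℓ} {c} (f : A → B) →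
                       (∀ {x y} → P x → P y → f x ≡ f y → x ≡ y) →
                       HasCardinality P c → HasCardinality (λ y → ∃[ x ] (P x × f x ≡ y)) c
HasCardinality-image f inj (xs , xs! , xs⇔P , refl) =
  map f xs ,
  map-unique f (λ x∈ y∈ → inj (to (xs⇔P _) x∈) (to (xs⇔P _) y∈)) xs! ,
  (λ y → mk⇔ (λ y∈ → let x , x∈xs , y≡fx = ∈-map⁻ f y∈ in x , to (xs⇔P x) x∈xs , sym y≡fx)
             (λ { (x , Px , refl) → ∈-map⁺ f (from (xs⇔P x) Px) })) ,
  length-map f xs

-- The fibres `Q x` may differ as sets but share the size `d`, just as the continuations after
-- different choices do.
HasCardinality-Σ : ∀ {A B : Set} {P : Pred A 0ℓ} {Q : A → Pred B 0ℓ} {c d} →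
                   HasCardinality P c → (∀ {x} → P x → HasCardinality (Q x) d) →
                   HasCardinality (λ (x , y) → P x × Q x y) (c * d)
HasCardinality-Σ {A} {B} {P} {Q} {d = d} (xs , xs! , xs⇔P , refl) Q-card =
  HasCardinality-⇔ (λ (x∈ , q) → to (xs⇔P _) x∈ , q) (λ (p , q) → from (xs⇔P _) p , q)
    (fibres xs! (λ x∈ → Q-card (to (xs⇔P _) x∈)))
  where
  -- Membership replaces `P`, so that induction can remove one first component at a time.
  fibres : ∀ {xs} → Unique xs → (∀ {x} → x ∈ xs → HasCardinality (Q x) d) →
           HasCardinality (λ (x , y) → x ∈ xs × Q x y) (length xs * d)
  fibres {[]}     []         card = [] , [] , (λ _ → mk⇔ (λ ()) (λ ())) , refl
  fibres {x ∷ xs} (x∉ ∷ xs!) card = HasCardinality-⇔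
    (λ { (inj₁ (y , q , refl)) → here refl , q ; (inj₂ (z∈ , q)) → there z∈ , q })
    (λ { (here refl , q) → inj₁ (_ , q , refl) ; (there z∈ , q) → inj₂ (z∈ , q) })
    (HasCardinality-⊎ (λ { (y , q , refl) (x∈ , _) → All.lookup x∉ x∈ refl })
      (HasCardinality-image (x ,_) (λ _ _ → cong proj₂) (card (here refl)))
      (fibres xs! (card ∘ there)))

-- Gaps.

-- The occupied payphone and the number of available payphones that follow it,
-- possibly 0.
Gap : ℕ → Set
Gap n = Fin n × ℕ

-- `Interval` without `nonempty`, so that two adjacent occupied payphones also bound a gap.
IsGap : ∀ {n} → Pred (Fin n) 0ℓ → Pred (Gap n) 0ℓ
IsGap P (f , s) = P f × (∀ i → i < s → ¬ P (f ⊕ suc i)) × P (f ⊕ suc s)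

interval⇒gap : ∀ {n} {P : Pred (Fin n) 0ℓ} (I : Interval P) → IsGap P (flank I , size I)
interval⇒gap I = occupiedˡ , available , occupiedʳ
  where open Interval I

gap⇒interval : ∀ {n} {P : Pred (Fin n) 0ℓ} {f s} → IsGap P (f , s) → 1 ≤ s → Interval P
gap⇒interval {f = f} {s} (Pf , ¬P , P-end) 1≤s = record
  { flank = f ; size = s ; nonempty = 1≤s
  ; occupiedˡ = Pf ; available = ¬P ; occupiedʳ = P-end }

gap-size-unique : ∀ {n} {P : Pred (Fin n) 0ℓ} {f s s′} →
                  IsGap P (f , s) → IsGap P (f , s′) → s ≡ s′
gap-size-unique {s = s} {s′} (_ , ¬P , P-end) (_ , ¬P′ , P-end′) with <-cmp s s′
... | tri< s<s′ _ _ = contradiction P-end (¬P′ s s<s′)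
... | tri≈ _ s≡s′ _ = s≡s′
... | tri> _ _ s′<s = contradiction P-end′ (¬P s′ s′<s)

-- Walking i + 1 steps back from the common payphone reaches an occupied one
-- in the first gap and, if i < i′, an available one in the second.
gap-payphone-≤ : ∀ {n} {P : Pred (Fin n) 0ℓ} {f f′ s s′ i i′} →
                 IsGap P (f , s) → IsGap P (f′ , s′) → i′ < s′ → i ≤ i′ →
                 f ⊕ suc i ≡ f′ ⊕ suc i′ → f ≡ f′ × i ≡ i′
gap-payphone-≤ {P = P} {f} {f′} {i = i} (Pf , _) (_ , ¬P , _) i′<s′ i≤i′ eq with m≤n⇒∃[o]m+o≡n i≤i′
... | zero , refl rewrite +-identityʳ i = ⊕-cancel (suc i) eq , refl
... | suc o , refl = contradiction (subst P f≡ Pf) (¬P o (<-trans (m≤n+m (suc o) i) i′<s′))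
  where
  f≡ : f ≡ f′ ⊕ suc o
  f≡ = ⊕-cancel (suc i) (trans eq (trans (cong (f′ ⊕_) (+-comm (suc i) (suc o)))
    (sym (⊕-assoc f′ (suc o) (suc i)))))

-- It shows both that distinct choices seat a person at distinct payphones and that seating a person
-- in one gap leaves the other gaps intact.
gap-payphone-injective : ∀ {n} {P : Pred (Fin n) 0ℓ} {f f′ s s′ i i′} →
                         IsGap P (f , s) → IsGap P (f′ , s′) → i < s → i′ < s′ →
                         f ⊕ suc i ≡ f′ ⊕ suc i′ → f ≡ f′ × i ≡ i′
gap-payphone-injective {i = i} {i′} gap gap′ i<s i′<s′ eq with ≤-total i i′
... | inj₁ i≤i′ = gap-payphone-≤ gap gap′ i′<s′ i≤i′ eq
... | inj₂ i′≤i with gap-payphone-≤ gap′ gap i<s i′≤i (sym eq)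
...   | f′≡f , i′≡i = sym f′≡f , sym i′≡i

-- The farthest payphones in a gap.

-- From `f ⊕ suc i`, the ends of the gap are `suc i` steps back and `s ∸ i` steps ahead.
clearance : ℕ → ℕ → ℕ
clearance s i = suc i ⊓ (s ∸ i)

clearance-suc : ∀ {m i} → i ≤ m → clearance (suc m) i ≡ suc (i ⊓ (m ∸ i))
clearance-suc {m} {i} i≤m = cong (suc i ⊓_) (+-∸-assoc 1 i≤m)

-- Bounding both `i` and `m ∸ i` from below traps `i` between the two halves, which differ by at
-- most one.
⌊/2⌋≤⇒middle : ∀ {m i} → i ≤ m → ⌊ m /2⌋ ≤ i ⊓ (m ∸ i) → Middle m i
⌊/2⌋≤⇒middle {m} {i} i≤m h≤ with m≤n⇒m<n∨m≡n (≤-trans h≤ (m⊓n≤m i (m ∸ i)))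
... | inj₂ h≡i = inj₁ (sym h≡i)
... | inj₁ h<i = inj₂ (≤-antisym i≤c (≤-trans (⌈n/2⌉≤1+⌊n/2⌋ m) h<i))
  where
  ⌈n/2⌉≤1+⌊n/2⌋ : ∀ n → ⌈ n /2⌉ ≤ suc ⌊ n /2⌋
  ⌈n/2⌉≤1+⌊n/2⌋ n = ⌊n/2⌋-mono (n≤1+n (suc n))
  i≤c : i ≤ ⌈ m /2⌉
  i≤c = +-cancelˡ-≤ ⌊ m /2⌋ _ _ (begin
    ⌊ m /2⌋ + i            ≤⟨ +-monoˡ-≤ i (≤-trans h≤ (m⊓n≤n i (m ∸ i))) ⟩
    m ∸ i + i              ≡⟨ m∸n+n≡m i≤m ⟩
    m                      ≡⟨ ⌊n/2⌋+⌈n/2⌉≡n m ⟨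
    ⌊ m /2⌋ + ⌈ m /2⌉      ∎)
    where open ≤-Reasoning

middle⇒⌊/2⌋≤ : ∀ {m i} → Middle m i → ⌊ m /2⌋ ≤ i ⊓ (m ∸ i)
middle⇒⌊/2⌋≤ {m} (inj₁ refl) = ⊓-glb ≤-refl (begin
  ⌊ m /2⌋                        ≤⟨ ⌊n/2⌋≤⌈n/2⌉ m ⟩
  ⌈ m /2⌉                        ≡⟨ m+n∸m≡n ⌊ m /2⌋ _ ⟨
  ⌊ m /2⌋ + ⌈ m /2⌉ ∸ ⌊ m /2⌋    ≡⟨ cong (_∸ ⌊ m /2⌋) (⌊n/2⌋+⌈n/2⌉≡n m) ⟩
  m ∸ ⌊ m /2⌋                    ∎)
  where open ≤-Reasoning
middle⇒⌊/2⌋≤ {m} (inj₂ refl) = ⊓-glb (⌊n/2⌋≤⌈n/2⌉ m) (begin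
  ⌊ m /2⌋                        ≡⟨ m+n∸n≡m ⌊ m /2⌋ ⌈ m /2⌉ ⟨
  ⌊ m /2⌋ + ⌈ m /2⌉ ∸ ⌈ m /2⌉    ≡⟨ cong (_∸ ⌈ m /2⌉) (⌊n/2⌋+⌈n/2⌉≡n m) ⟩
  m ∸ ⌈ m /2⌉                    ∎)
  where open ≤-Reasoning

-- Twice the minimum is at most `i + (m ∸ i)`, which is `m`.
⊓-∸-≤-⌊/2⌋ : ∀ {m i} → i ≤ m → i ⊓ (m ∸ i) ≤ ⌊ m /2⌋
⊓-∸-≤-⌊/2⌋ {m} {i} i≤m = begin
  x                ≡⟨ n≡⌊n+n/2⌋ x ⟩
  ⌊ x + x /2⌋      ≤⟨ ⌊n/2⌋-mono (+-mono-≤ (m⊓n≤m i _) (m⊓n≤n i _)) ⟩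
  ⌊ i + (m ∸ i) /2⌋ ≡⟨ cong ⌊_/2⌋ (m+[n∸m]≡n i≤m) ⟩
  ⌊ m /2⌋          ∎
  where
  open ≤-Reasoning
  x = i ⊓ (m ∸ i)

clearance-maximal⇒middle : ∀ {m i} → i < suc m →
  (∀ i′ → i′ < suc m → clearance (suc m) i′ ≤ clearance (suc m) i) → Middle m i
clearance-maximal⇒middle {m} {i} (s≤s i≤m) max = ⌊/2⌋≤⇒middle i≤m
  (≤-trans (middle⇒⌊/2⌋≤ (inj₁ refl)) (s≤s⁻¹ (subst₂ _≤_ (clearance-suc (⌊n/2⌋≤n m)) (clearance-suc i≤m)
    -- Comparison with the offset `⌊ m /2⌋`, which attains the optimum.
    (max ⌊ m /2⌋ (s≤s (⌊n/2⌋≤n m))))))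

middle⇒clearance-maximal : ∀ {m i} → Middle m i →
  ∀ i′ → i′ < suc m → clearance (suc m) i′ ≤ clearance (suc m) i
middle⇒clearance-maximal {m} {i} mid i′ (s≤s i′≤m) = subst₂ _≤_
  (sym (clearance-suc i′≤m)) (sym (clearance-suc (Middle-≤ mid)))
  (s≤s (≤-trans (⊓-∸-≤-⌊/2⌋ i′≤m) (middle⇒⌊/2⌋≤ mid)))

distanceToClosest-unique : ∀ {n} {P : Pred (Fin n) 0ℓ} {j d d′} →
  DistanceToClosest P j d → DistanceToClosest P j d′ → d ≡ d′
distanceToClosest-unique {P = P} {j} D D′ = ≤-antisym (half D D′) (half D′ D)
  where
  half : ∀ {d d′} → DistanceToClosest P j d → DistanceToClosest P j d′ → d ≤ d′
  half (_ , d≤) ((o , Po , refl) , _) = d≤ o Po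

-- A walk that stops short of the end of the gap meets only available payphones, which bounds every
-- distance from below; the nearer end attains the bound. Speaking of walks also covers the case
-- where both ends are one payphone.
clearance-distance : ∀ {n} {P : Pred (Fin n) 0ℓ} {f s i} → IsGap P (f , s) → i < s →
                     DistanceToClosest P (f ⊕ suc i) (clearance s i)
clearance-distance {P = P} {f} {s} {i} (Pf , ¬P , P-end) i<s = attained , lower
  where
  j = f ⊕ suc i
  lower : ∀ o → P o → clearance s i ≤ circularDistance j o
  lower o Po with circularDistance-reached j o
  ... | inj₁ j⊕d≡o = ≤-trans (m⊓n≤n (suc i) _) (m≤n+o⇒m∸n≤o s i (≮⇒≥ λ i+d<s →
    ¬P (i + circularDistance j o) i+d<s (subst P (trans (sym j⊕d≡o) (⊕-assoc f (suc i) _)) Po)))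
  ... | inj₂ o⊕d≡j = ≤-trans (m⊓n≤m (suc i) _) (≮⇒≥ before)
    where
    before : ¬ circularDistance j o < suc i
    before d<1+i with m≤n⇒∃[o]m+o≡n d<1+i
    ... | k , d+k≡i = ¬P k (≤-<-trans (≤-trans (m≤n+m k _) (≤-reflexive (suc-injective d+k≡i))) i<s)
      (subst P o≡ Po)
      where
      -- Going back `d` steps from offset `i` leads to offset `k`, where `d + k = i`.
      o≡ : o ≡ f ⊕ suc k
      o≡ = ⊕-cancel (circularDistance j o) (trans o⊕d≡j (trans
        (cong (f ⊕_) (trans (sym d+k≡i) (trans (sym (+-suc _ k)) (+-comm _ (suc k)))))
        (sym (⊕-assoc f (suc k) _))))
  attained : ∃[ o ] (P o × circularDistance j o ≡ clearance s i)
  attained with ≤-total (suc i) (s ∸ i)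
  ... | inj₁ left≤right = f , Pf , ≤-antisym
    (≤-trans (≤-reflexive (circularDistance-sym j f))
      (≤-trans (circularDistance-⊕ f (suc i)) (≤-reflexive (sym (m≤n⇒m⊓n≡m left≤right)))))
    (lower f Pf)
  ... | inj₂ right≤left = f ⊕ suc s , P-end , ≤-antisym
    (≤-trans (≤-reflexive (cong (circularDistance j) end≡))
      (≤-trans (circularDistance-⊕ j (s ∸ i)) (≤-reflexive (sym (m≥n⇒m⊓n≡n right≤left)))))
    (lower (f ⊕ suc s) P-end)
    where
    end≡ : f ⊕ suc s ≡ j ⊕ (s ∸ i)
    end≡ = trans (cong (λ x → f ⊕ suc x) (sym (m+[n∸m]≡n (<⇒≤ i<s)))) (sym (⊕-assoc f (suc i) _))

farthest⇒clearance-maximal : ∀ {n} {P : Pred (Fin n) 0ℓ} (I : Interval P) {i} → i < size I →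
  FarthestIn I (flank I ⊕ suc i) → ∀ i′ → i′ < size I → clearance (size I) i′ ≤ clearance (size I) i
farthest⇒clearance-maximal I i<s far i′ i′<s = far _ (i′ , i′<s , refl) _ _
  (clearance-distance (interval⇒gap I) i<s) (clearance-distance (interval⇒gap I) i′<s)

clearance-maximal⇒farthest : ∀ {n} {P : Pred (Fin n) 0ℓ} (I : Interval P) {i} → i < size I →
  (∀ i′ → i′ < size I → clearance (size I) i′ ≤ clearance (size I) i) → FarthestIn I (flank I ⊕ suc i)
clearance-maximal⇒farthest {P = P} I {i} i<s max j′ (i′ , i′<s , refl) d d′ D D′ = subst₂ _≤_
  (distanceToClosest-unique {P = P} {j′} (clearance-distance (interval⇒gap I) i′<s) D′)
  (distanceToClosest-unique {P = P} {flank I ⊕ suc i} (clearance-distance (interval⇒gap I) i<s) D)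
  (max i′ i′<s)

-- States as lists of gaps.

-- The flanks are exactly the occupied payphones, each listed once. The list order is unrelated to
-- the circle, so the list may be permuted freely.
record Partition {n} (P : Pred (Fin n) 0ℓ) (G : List (Gap n)) : Set where
  field
    flanks!  : Unique (map proj₁ G)
    complete : ∀ {j} → P j → j ∈ map proj₁ G
    gaps     : All (IsGap P) G

open Partition

sizes : ∀ {n} → List (Gap n) → List ℕ
sizes = map proj₂

total : ∀ {n} → List (Gap n) → Multiset
total G = concatMap S (sizes G)

insert : ∀ {n} → Fin n → Pred (Fin n) 0ℓ → Pred (Fin n) 0ℓ
insert x P j = j ≡ x ⊎ P j

partition-↭ : ∀ {n} {P : Pred (Fin n) 0ℓ} {G G′} → G ↭ G′ → Partition P G → Partition P G′
partition-↭ G↭G′ part = record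
  { flanks!  = Unique-resp-↭ (setoid _) (↭⇒↭ₛ (↭.map⁺ proj₁ G↭G′)) (part .flanks!)
  ; complete = ↭.∈-resp-↭ (↭.map⁺ proj₁ G↭G′) ∘ part .complete
  ; gaps     = ↭.All-resp-↭ G↭G′ (part .gaps)
  }

-- Completeness lists the flank, and the flank determines the size. Hence every `Interval` is
-- listed, and `Longest` can be read off `maximum (sizes G)`.
partition-∈ : ∀ {n} {P : Pred (Fin n) 0ℓ} {G g} → Partition P G → IsGap P g → g ∈ G
partition-∈ {P = P} part gap@(Pf , _) with ∈-map⁻ proj₁ (part .complete Pf)
... | (_ , s′) , g′∈G , refl with gap-size-unique {P = P} gap (All.lookup (part .gaps) g′∈G)
...   | refl = g′∈G

splitGap : ∀ {n} → Fin n → ℕ → ℕ → List (Gap n) → List (Gap n)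
splitGap f m i G = (f , i) ∷ (f ⊕ suc i , m ∸ i) ∷ G

partition-split : ∀ {n} {P : Pred (Fin n) 0ℓ} {f m i G} → i ≤ m → Partition P ((f , suc m) ∷ G) →
                  Partition (insert (f ⊕ suc i) P) (splitGap f m i G)
partition-split {P = P} {f} {m} {i} {G} i≤m part with part .flanks! | part .gaps
... | f∉ ∷ G! | gap@(Pf , ¬P , P-end) ∷ gapsG = record
  { flanks!  = ((λ f≡x → ¬Px (subst P f≡x Pf)) ∷ f∉)
             ∷ All.tabulate (λ y∈ x≡y → ¬Px (subst P (sym x≡y) (flank-occupied y∈)))
             ∷ G!
  ; complete = λ where
      (inj₁ refl) → there (here refl)
      (inj₂ Pj)   → case (part .complete Pj)
  ; gaps     = left ∷ right ∷ All.tabulate other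
  }
  where
  x = f ⊕ suc i
  ¬Px : ¬ P x
  ¬Px = ¬P i (s≤s i≤m)
  flank-occupied : ∀ {j} → j ∈ map proj₁ G → P j
  flank-occupied j∈ with ∈-map⁻ proj₁ j∈
  ... | _ , g∈G , refl = proj₁ (All.lookup gapsG g∈G)
  case : ∀ {j} → j ∈ f ∷ map proj₁ G → j ∈ f ∷ x ∷ map proj₁ G
  case (here j≡f)  = here j≡f
  case (there j∈) = there (there j∈)
  left : IsGap (insert x P) (f , i)
  left = inj₂ Pf
       , (λ k k<i → λ where
           (inj₁ eq) → <⇒≢ k<i (proj₂ (gap-payphone-injective {P = P} gap gap
                         (<-trans k<i (s≤s i≤m)) (s≤s i≤m) eq))
           (inj₂ Pk) → ¬P k (<-trans k<i (s≤s i≤m)) Pk)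
       , inj₁ refl
  shifted : ∀ k → x ⊕ suc k ≡ f ⊕ suc (i + suc k)
  shifted k = ⊕-assoc f (suc i) (suc k)
  right : IsGap (insert x P) (x , m ∸ i)
  right = inj₁ refl
        , (λ k k<m∸i → let i+k< = s≤s (≤-trans (+-monoʳ-≤ i k<m∸i) (≤-reflexive (m+[n∸m]≡n i≤m))) in λ where
            (inj₁ eq) → <⇒≢ (m<m+n i z<s) (sym (proj₂ (gap-payphone-injective {P = P} gap gap i+k< (s≤s i≤m)
                          (trans (sym (shifted k)) eq))))
            (inj₂ Pk) → ¬P (i + suc k) i+k< (subst P (shifted k) Pk))
        -- Going `suc (m ∸ i)` steps from `x` means going `suc (suc m)` steps from `f`, to the old
        -- end.
        , inj₂ (subst P (sym (trans (shifted (m ∸ i))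
            (cong (λ y → f ⊕ suc y) (trans (+-suc i _) (cong suc (m+[n∸m]≡n i≤m)))))) P-end)
  other : ∀ {g} → g ∈ G → IsGap (insert x P) g
  other {f′ , s′} g∈G with All.lookup gapsG g∈G
  ... | gap′@(Pf′ , ¬P′ , P-end′) = inj₂ Pf′
    , (λ k k<s′ → λ where
        -- If `x` lay in this gap too, its flank would be `f`, which is listed only once.
        (inj₁ eq) → All.lookup f∉ (∈-map⁺ proj₁ g∈G)
                      (sym (proj₁ (gap-payphone-injective {P = P} gap′ gap k<s′ (s≤s i≤m) eq)))
        (inj₂ Pk) → ¬P′ k k<s′ Pk)
    , inj₂ P-end′

total-↭ : ∀ {n} {G G′ : List (Gap n)} → G ↭ G′ → total G ↭ total G′
total-↭ ↭.refl                          = ↭.refl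
total-↭ (↭.prep (_ , s) p)              = ↭.++⁺ˡ (S s) (total-↭ p)
total-↭ {G′ = G′} (↭.swap (_ , s) (_ , s′) p) =
  ↭-trans (↭.++⁺ˡ (S s) (↭.++⁺ˡ (S s′) (total-↭ p))) (↭.shifts (S s) (S s′))
total-↭ (↭.trans p q)                   = ↭-trans (total-↭ p) (total-↭ q)

total-split : ∀ {n} {f : Fin n} {m i} G → Middle m i →
              total ((f , suc m) ∷ G) ↭ suc m ∷ total (splitGap f m i G)
total-split {m = m} {i} G mid = ↭-trans (↭.++⁺ʳ (total G) (S-split mid))
  (↭-reflexive (cong (suc m ∷_) (++-assoc (S i) (S (m ∸ i)) (total G))))

maximum-∈ : ∀ M → 0 < maximum M → maximum M ∈ M
maximum-∈ (x ∷ M) 0<max with ⊔-sel x (maximum M)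
... | inj₁ eq = here eq
... | inj₂ eq = there (subst (_∈ M) (sym eq) (maximum-∈ M (subst (0 <_) eq 0<max)))

total-maximum-0 : ∀ {n} (G : List (Gap n)) → maximum (sizes G) ≡ 0 → total G ≡ []
total-maximum-0 []             _   = refl
total-maximum-0 ((_ , zero) ∷ G) eq = total-maximum-0 G eq
total-maximum-0 ((_ , suc s) ∷ G) eq =
  contradiction (≤-trans (m≤m⊔n (suc s) (maximum (sizes G))) (≤-reflexive eq)) λ ()

position : ∀ {n} → Gap n × ℕ → Fin n
position ((f , _) , i) = f ⊕ suc i

-- The number of allowed payphones.

Choice : ∀ {n} → ℕ → List (Gap n) → Pred (Gap n × ℕ) 0ℓ
Choice m G (g , i) = (g ∈ G × suc m ≡ proj₂ g) × Middle m i

allowed⇒choice : ∀ {n} {P : Pred (Fin n) 0ℓ} {G m j} → Partition P G → maximum (sizes G) ≡ suc m →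
                 AllowedC₂ P j → ∃[ c ] (Choice m G c × position c ≡ j)
allowed⇒choice {G = G} {m} part max≡ (I , longest , (i , i<s , refl) , far) =
  _ , ((g∈G , sym s≡) , clearance-maximal⇒middle (subst (i <_) s≡ i<s)
    (subst (λ s → ∀ i′ → i′ < s → clearance s i′ ≤ clearance s i) s≡ (farthest⇒clearance-maximal I i<s far))) , refl
  where
  g∈G : (flank I , size I) ∈ G
  g∈G = partition-∈ part (interval⇒gap I)
  s≤ : size I ≤ suc m
  s≤ = subst (size I ≤_) max≡ (All.lookup (≤-maximum (sizes G)) (∈-map⁺ proj₂ g∈G))
  -- A gap of maximal size is nonempty, hence an interval that `I` must match.
  ≤s : suc m ≤ size I
  ≤s with ∈-map⁻ proj₂ (subst (_∈ sizes G) max≡ (maximum-∈ (sizes G) (subst (0 <_) (sym max≡) z<s)))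
  ... | _ , g′∈G , refl = longest (gap⇒interval (All.lookup (part .gaps) g′∈G) (s≤s z≤n))
  s≡ : size I ≡ suc m
  s≡ = ≤-antisym s≤ ≤s

choice⇒allowed : ∀ {n} {P : Pred (Fin n) 0ℓ} {G m c} → Partition P G → maximum (sizes G) ≡ suc m →
                 Choice m G c → AllowedC₂ P (position c)
choice⇒allowed {P = P} {G} {m} {(f , _) , i} part max≡ ((g∈G , refl) , mid) =
  I , longest , (i , i<s , refl) , clearance-maximal⇒farthest I i<s (middle⇒clearance-maximal mid)
  where
  i<s : i < suc m
  i<s = s≤s (Middle-≤ mid)
  I : Interval P
  I = gap⇒interval (All.lookup (part .gaps) g∈G) (s≤s z≤n)
  longest : Longest I
  longest I′ = subst (size I′ ≤_) max≡
    (All.lookup (≤-maximum (sizes G)) (∈-map⁺ proj₂ (partition-∈ part (interval⇒gap I′))))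

-- One `c` serves as the number of middle offsets and as the factor in `F`, so the induction never
-- splits on parity.
middle-weight : ∀ m → ∃[ c ] (HasCardinality (Middle m) c ×
                             (∀ M → F (suc m ∷ M) ≡ suc (#[ suc m ] M) * c * F M))
middle-weight m with halve m
... | h , inj₁ refl = 1
  , (h ∷ [] , [] ∷ []
    , (λ _ → mk⇔ (λ { (here refl) → inj₁ (n≡⌊n+n/2⌋ h) })
        λ { (inj₁ eq) → here (trans eq (sym (n≡⌊n+n/2⌋ h)))
          ; (inj₂ eq) → here (trans eq (sym (n≡⌈n+n/2⌉ h))) })
    , refl)
  , F-∷-odd h
... | h , inj₂ refl = 2
  , (h ∷ suc h ∷ [] , (<⇒≢ (n<1+n h) ∷ []) ∷ [] ∷ []
    , (λ _ → mk⇔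
        (λ { (here refl)         → inj₁ (n≡⌈n+n/2⌉ h)
           ; (there (here refl)) → inj₂ (cong suc (n≡⌊n+n/2⌋ h)) })
        λ { (inj₁ eq) → here (trans eq (sym (n≡⌈n+n/2⌉ h)))
          ; (inj₂ eq) → there (here (trans eq (cong suc (sym (n≡⌊n+n/2⌋ h))))) })
    , refl)
  , F-∷-even h

gaps-of-size : ∀ {n} {G : List (Gap n)} → Unique (map proj₁ G) → ∀ k →
               HasCardinality (λ g → g ∈ G × k ≡ proj₂ g) (#[ k ] (sizes G))
gaps-of-size {G = G} G! k =
  filter ((k ≟_) ∘ proj₂) G
  , Unique.filter⁺ _ (Unique.map⁻ G!)
  , (λ g → mk⇔ (∈-filter⁻ _) (uncurry (∈-filter⁺ _)))
  , count G
  where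
  count : ∀ G → length (filter ((k ≟_) ∘ proj₂) G) ≡ #[ k ] (sizes G)
  count []            = refl
  -- Both filters decide by `k ≟ s`, whose Boolean part is `k ≡ᵇ s`.
  count ((_ , s) ∷ G) with k ≡ᵇ s
  ... | true  = cong suc (count G)
  ... | false = count G

allowed-cardinality : ∀ {n} {P : Pred (Fin n) 0ℓ} {G m c} → Partition P G → maximum (sizes G) ≡ suc m →
                      HasCardinality (Middle m) c → HasCardinality (AllowedC₂ P) (#[ suc m ] (total G) * c)
allowed-cardinality {P = P} {G} {m} {c} part max≡ middles =
  subst (λ k → HasCardinality (AllowedC₂ P) (k * c))
    (sym (#-concatMap-S m (subst (λ x → All (_≤ x) (sizes G)) max≡ (≤-maximum (sizes G)))))
    (HasCardinality-⇔
      (λ { (c , choice , refl) → choice⇒allowed part max≡ choice })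
      (allowed⇒choice part max≡)
      (HasCardinality-image position position-injective
        (HasCardinality-Σ (gaps-of-size (part .flanks!) (suc m)) (λ _ → middles))))
  where
  position-injective : ∀ {c c′} → Choice m G c → Choice m G c′ → position c ≡ position c′ → c ≡ c′
  position-injective {(f , _) , i} {(f′ , _) , i′} ((g∈ , refl) , mid) ((g′∈ , refl) , mid′) eq
    with gap-payphone-injective (All.lookup (part .gaps) g∈) (All.lookup (part .gaps) g′∈)
           (s≤s (Middle-≤ mid)) (s≤s (Middle-≤ mid′)) eq
  ... | refl , refl = refl

-- Counting the continuations of a state.

-- The rule started from an arbitrary occupied set and peeled off one person at a time, as the
-- induction requires.
Plays : ∀ {n m} → Pred (Fin n) 0ℓ → Pred (Vec (Fin n) m) 0ℓ
Plays P []      = ⊤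
Plays P (x ∷ v) = AllowedC₂ P x × Plays (insert x P) v

∈-↭ : ∀ {A : Set} {x : A} {xs} → x ∈ xs → ∃[ ys ] xs ↭ x ∷ ys
∈-↭ x∈xs with ∈-∃++ x∈xs
... | ys , zs , refl = ys ++ zs , ↭.shift _ ys zs

choice-split : ∀ {n} {P : Pred (Fin n) 0ℓ} {G m c} → Partition P G → Choice m G c →
               ∃[ G′ ] (Partition (insert (position c) P) G′ × total G ↭ suc m ∷ total G′)
choice-split {c = (f , _) , i} part ((g∈G , refl) , mid) with ∈-↭ g∈G
... | rest , G↭ = splitGap f _ i rest
  , partition-split (Middle-≤ mid) (partition-↭ G↭ part)
  , ↭-trans (total-↭ G↭) (total-split {f = f} rest mid)

plays-cardinality : ∀ {n} m {P : Pred (Fin n) 0ℓ} {G} → Partition P G → length (total G) ≡ m →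
                    HasCardinality (Plays {m = m} P) (F (total G))
-- The empty play is the only one, and `F []` computes to 1.
plays-cardinality zero {G = G} part len with total G
... | [] = [] ∷ [] , [] ∷ [] , (λ { [] → mk⇔ (λ _ → tt) (λ _ → here refl) }) , refl
plays-cardinality (suc m) {P} {G} part len with maximum (sizes G) in max≡
... | zero  = contradiction (trans (sym len) (cong length (total-maximum-0 G max≡))) λ ()
... | suc k
  with c , middles , weight ← middle-weight k
  with g , g∈G , k≡ ← ∈-map⁻ proj₂ (subst (_∈ sizes G) max≡ (maximum-∈ (sizes G) (subst (0 <_) (sym max≡) z<s)))
  -- A reference successor, from some longest gap split at `⌊ m /2⌋` with `m = k`; it fixes the
  -- common fibre size before the actual choice is known.
  with G₀ , _ , G↭ ← choice-split part ((g∈G , k≡) , inj₁ refl)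
  = subst (HasCardinality (Plays P)) (sym F≡)
      (HasCardinality-⇔
        (λ { (_ , allowed , refl) → allowed })
        (λ { {x ∷ v} allowed → (x , v) , allowed , refl })
        (HasCardinality-image (uncurry _∷_) (λ { _ _ refl → refl })
          (HasCardinality-Σ (allowed-cardinality part max≡ middles) continue)))
  where
  F≡ : F (total G) ≡ #[ suc k ] (total G) * c * F (total G₀)
  F≡ = trans (F-↭ G↭) (trans (weight (total G₀))
    (cong (λ x → x * c * F (total G₀)) (sym (trans (#-↭ G↭ (suc k)) (#-≡ (suc k) (total G₀))))))
  continue : ∀ {x} → AllowedC₂ P x → HasCardinality (Plays {m = m} (insert x P)) (F (total G₀))
  continue allowed with allowed⇒choice part max≡ allowed
  ... | _ , choice , refl with choice-split part choice
  ...   | G′ , part′ , G↭′ =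
    -- Both totals arise from `total G` by removing one `suc k`, so cancelling it identifies them up
    -- to permutation.
    subst (HasCardinality _) (F-↭ (↭.drop-∷ (↭-trans (↭-sym G↭′) G↭)))
      (plays-cardinality m part′ (suc-injective (trans (sym (↭.↭-length G↭′)) len)))

-- From continuations to seatings.

Interval-⇔ : ∀ {n} {P Q : Pred (Fin n) 0ℓ} → P ⊆ Q → Q ⊆ P → Interval P → Interval Q
Interval-⇔ P⊆Q Q⊆P I = record
  { flank = I.flank ; size = I.size ; nonempty = I.nonempty
  ; occupiedˡ = P⊆Q I.occupiedˡ
  ; available = λ i i<s → I.available i i<s ∘ Q⊆P
  ; occupiedʳ = P⊆Q I.occupiedʳ
  }
  where module I = Interval I

-- The various descriptions of one occupied set are only logically equivalent, so `subst` cannot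
-- pass between them.
AllowedC₂-⇔ : ∀ {n} {P Q : Pred (Fin n) 0ℓ} → P ⊆ Q → Q ⊆ P → AllowedC₂ P ⊆ AllowedC₂ Q
AllowedC₂-⇔ {P = P} {Q} P⊆Q Q⊆P {j} (I , longest , j∈I , far) =
  Interval-⇔ P⊆Q Q⊆P I , longest ∘ Interval-⇔ Q⊆P P⊆Q , j∈I ,
  λ j′ j′∈I d d′ D D′ → far j′ j′∈I d d′ (back j D) (back j′ D′)
  where
  back : ∀ j {d} → DistanceToClosest Q j d → DistanceToClosest P j d
  back _ ((o , Qo , eq) , d≤) = (o , Q⊆P Qo , eq) , λ o Po → d≤ o (P⊆Q Po)

-- Interpolates between `Plays` and `FollowsC₂`: the head of the vector can move into `P` without
-- changing the occupied set.
OccupiedWith : ∀ {n m} → Pred (Fin n) 0ℓ → Vec (Fin n) m → Fin m → Pred (Fin n) 0ℓ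
OccupiedWith P v t j = P j ⊎ ∃[ e ] (e Fin.< t × lookup v e ≡ j)

occupied-suc⇒ : ∀ {n m} {P : Pred (Fin n) 0ℓ} {x} (v : Vec (Fin n) m) t →
                OccupiedWith (insert x P) v t ⊆ OccupiedWith P (x ∷ v) (Fin.suc t)
occupied-suc⇒ v t (inj₁ (inj₁ refl))     = inj₂ (Fin.zero , z<s , refl)
occupied-suc⇒ v t (inj₁ (inj₂ Pj))       = inj₁ Pj
occupied-suc⇒ v t (inj₂ (e , e<t , eq)) = inj₂ (Fin.suc e , s<s e<t , eq)

occupied-suc⇐ : ∀ {n m} {P : Pred (Fin n) 0ℓ} {x} (v : Vec (Fin n) m) t →
                OccupiedWith P (x ∷ v) (Fin.suc t) ⊆ OccupiedWith (insert x P) v t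
occupied-suc⇐ v t (inj₁ Pj)                     = inj₁ (inj₂ Pj)
occupied-suc⇐ v t (inj₂ (Fin.zero  , _ , refl))     = inj₁ (inj₁ refl)
occupied-suc⇐ v t (inj₂ (Fin.suc e , s<s e<t , eq)) = inj₂ (e , e<t , eq)

plays⇒allowed : ∀ {n m} {P : Pred (Fin n) 0ℓ} (v : Vec (Fin n) m) → Plays P v →
                ∀ t → AllowedC₂ (OccupiedWith P v t) (lookup v t)
plays⇒allowed {P = P} (x ∷ v) (allowed , _) Fin.zero =
  AllowedC₂-⇔ {P = P} {OccupiedWith P (x ∷ v) Fin.zero}
    inj₁ (λ { (inj₁ Pj) → Pj ; (inj₂ (_ , () , _)) }) allowed
plays⇒allowed {P = P} (x ∷ v) (_ , plays) (Fin.suc t) =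
  AllowedC₂-⇔ (occupied-suc⇒ {P = P} v t) (occupied-suc⇐ {P = P} v t) (plays⇒allowed {P = insert x P} v plays t)

allowed⇒plays : ∀ {n m} {P : Pred (Fin n) 0ℓ} (v : Vec (Fin n) m) →
                (∀ t → AllowedC₂ (OccupiedWith P v t) (lookup v t)) → Plays P v
allowed⇒plays []      _       = tt
allowed⇒plays {P = P} (x ∷ v) allowed =
  AllowedC₂-⇔ {P = OccupiedWith P (x ∷ v) Fin.zero} {P}
    (λ { (inj₁ Pj) → Pj ; (inj₂ (_ , () , _)) }) inj₁ (allowed Fin.zero) ,
  allowed⇒plays {P = insert x P} v (λ t →
    AllowedC₂-⇔ (occupied-suc⇐ {P = P} v t) (occupied-suc⇒ {P = P} v t) (allowed (Fin.suc t)))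

occupied-first⇒ : ∀ {n m} {x : Fin n} (v : Vec (Fin n) m) t {j} →
                  OccupiedWith (_≡ x) v t j → ∃[ e ] (e Fin.< Fin.suc t × lookup (x ∷ v) e ≡ j)
occupied-first⇒ v t (inj₁ refl)           = Fin.zero , z<s , refl
occupied-first⇒ v t (inj₂ (e , e<t , eq)) = Fin.suc e , s<s e<t , eq

occupied-first⇐ : ∀ {n m} {x : Fin n} (v : Vec (Fin n) m) t {j} →
                  ∃[ e ] (e Fin.< Fin.suc t × lookup (x ∷ v) e ≡ j) → OccupiedWith (_≡ x) v t j
occupied-first⇐ v t (Fin.zero  , _ , eq)       = inj₁ (sym eq)
occupied-first⇐ v t (Fin.suc e , s<s e<t , eq) = inj₂ (e , e<t , eq)

-- The only gap has `x` at both ends: a full turn is the first return to `x`.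
initial-partition : ∀ {m} (x : Fin (suc m)) → Partition (_≡ x) ((x , m) ∷ [])
initial-partition {m} x = record
  { flanks!  = [] ∷ []
  ; complete = here
  ; gaps     = (refl , (λ i i<m eq → contradiction (⊕-fixed x (s<s i<m) eq) λ ()) , ⊕-cycle x) ∷ []
  }

Seating : ∀ {n} → Pred (Vec (Fin n) n) 0ℓ
Seating v = FollowsC₂ (lookup v)

seating-cardinality : ∀ m → HasCardinality (Seating {suc m}) (suc m * F (S m))
seating-cardinality m = HasCardinality-⇔
  (λ { ((x , v) , (_ , plays) , refl) → λ where
    (Fin.suc t) _ → AllowedC₂-⇔ (occupied-first⇒ v t) (occupied-first⇐ v t) (plays⇒allowed v plays t) })
  (λ { {x ∷ v} follows → (x , v)
     , (tt , allowed⇒plays v (λ t →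
         AllowedC₂-⇔ (occupied-first⇐ v t) (occupied-first⇒ v t) (follows (Fin.suc t) (s≤s z≤n))))
     , refl })
  (HasCardinality-image (uncurry _∷_) (λ { _ _ refl → refl })
    (HasCardinality-Σ all-first λ {x} _ →
      -- The total of the single initial gap is `S m ++ []`.
      subst (λ M → HasCardinality (Plays {m = m} (_≡ x)) (F M)) (++-identityʳ (S m))
        (plays-cardinality m {_≡ x} (initial-partition x)
          (trans (cong length (++-identityʳ (S m))) (length-S m)))))
  where
  all-first : HasCardinality {Fin (suc m)} (const ⊤) (suc m)
  all-first = allFin (suc m) , Unique.allFin⁺ (suc m)
            , (λ x → mk⇔ (λ _ → tt) (λ _ → ∈-allFin x)) , length-tabulate {n = suc m} id

-- From seatings to permutations.

follows⇒≢ : ∀ {n} {seat : Fin n → Fin n} → FollowsC₂ seat → ∀ {e t} → e Fin.< t → seat e ≢ seat t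
follows⇒≢ {seat = seat} follows {e} {t} e<t eq with follows t (≤-trans (s≤s z≤n) e<t)
... | I , _ , (i , i<s , seat≡) , _ = Interval.available I i i<s (e , e<t , trans eq (sym seat≡))

follows⇒injective : ∀ {n} {seat : Fin n → Fin n} → FollowsC₂ seat → Injective _≡_ _≡_ seat
follows⇒injective follows {s} {t} eq with Fin.<-cmp s t
... | tri< s<t _ _ = contradiction eq (follows⇒≢ follows s<t)
... | tri≈ _ s≡t _ = s≡t
... | tri> _ _ t<s = contradiction (sym eq) (follows⇒≢ follows t<s)

-- Punching out a missed value would inject `Fin (suc n)` into `Fin n`.
injective⇒surjective : ∀ {n} {f : Fin n → Fin n} → Injective _≡_ _≡_ f → ∀ j → ∃[ i ] f i ≡ j
injective⇒surjective {suc n} {f} inj j with Fin.any? (λ i → f i Fin.≟ j)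
... | yes preimage = preimage
... | no  missed   = contradiction
  (Fin.injective⇒≤ {f = λ i → Fin.punchOut (j≢ i)} (λ {x} {y} eq → inj (Fin.punchOut-injective (j≢ x) (j≢ y) eq)))
  1+n≰n
  where
  j≢ : ∀ i → j ≢ f i
  j≢ i eq = missed (i , sym eq)

-- The last clause is never reached for a seating, which is a bijection.
personAt : ∀ {n} → Vec (Fin n) n → Fin n → Fin n
personAt v j with Fin.any? (λ t → lookup v t Fin.≟ j)
... | yes (t , _) = t
... | no  _       = j

permutation : ∀ {n} → Vec (Fin n) n → Vec (Fin n) n
permutation v = tabulate (personAt v)

lookup-personAt : ∀ {n} (v : Vec (Fin n) n) → Seating v → ∀ j → lookup v (personAt v j) ≡ j
lookup-personAt v seating j with Fin.any? (λ t → lookup v t Fin.≟ j)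
... | yes (_ , eq) = eq
... | no  missed   = contradiction (injective⇒surjective (follows⇒injective seating) j) missed

personAt-lookup : ∀ {n} (v : Vec (Fin n) n) → Seating v → ∀ t → personAt v (lookup v t) ≡ t
personAt-lookup v seating t = follows⇒injective seating (lookup-personAt v seating (lookup v t))

lookup-extensional : ∀ {n m} (v w : Vec (Fin n) m) → (∀ t → lookup v t ≡ lookup w t) → v ≡ w
lookup-extensional v w eq = trans (sym (tabulate∘lookup v)) (trans (tabulate-cong eq) (tabulate∘lookup w))

-- A bijection is determined by its inverse.
permutation-injective : ∀ {n} {v w : Vec (Fin n) n} → Seating v → Seating w →
                        permutation v ≡ permutation w → v ≡ w
permutation-injective {v = v} {w} seating-v seating-w eq = lookup-extensional v w λ t → begin
  lookup v t                            ≡⟨ lookup-personAt w seating-w (lookup v t) ⟨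
  lookup w (personAt w (lookup v t))    ≡⟨ cong (lookup w) (personAt≡ (lookup v t)) ⟨
  lookup w (personAt v (lookup v t))    ≡⟨ cong (lookup w) (personAt-lookup v seating-v t) ⟩
  lookup w t                            ∎
  where
  open ≡-Reasoning
  personAt≡ : ∀ j → personAt v j ≡ personAt w j
  personAt≡ j = trans (sym (lookup∘tabulate (personAt v) j))
    (trans (cong (λ p → lookup p j) eq) (lookup∘tabulate (personAt w) j))

FollowsC₂-≗ : ∀ {n} {f g : Fin n → Fin n} → (∀ t → f t ≡ g t) → FollowsC₂ f → FollowsC₂ g
FollowsC₂-≗ {f = f} {g} f≗g follows t 1≤t = subst (AllowedC₂ (OccupiedBefore g t)) (f≗g t)
  (AllowedC₂-⇔ (λ (e , e<t , eq) → e , e<t , trans (sym (f≗g e)) eq)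
               (λ (e , e<t , eq) → e , e<t , trans (f≗g e) eq) (follows t 1≤t))

theorem2 : ∀ (n : ℕ) → 1 ≤ n → C₂[ n ]≡ n * F (S (n ∸ 1))
theorem2 (suc m) _ = HasCardinality-⇔
  (λ { (v , seating , refl) → lookup v , seating , λ t →
    trans (lookup∘tabulate (personAt v) (lookup v t)) (personAt-lookup v seating t) })
  (λ { {p} (seat , follows , p∘seat) →
    -- Seatings are counted as vectors; `lookup v` agrees with `seat` only pointwise, hence
    -- `FollowsC₂-≗`.
    let v       = tabulate seat
        seating = FollowsC₂-≗ (λ t → sym (lookup∘tabulate seat t)) follows
    in v , seating , lookup-extensional (permutation v) p λ j → begin
      lookup (permutation v) j              ≡⟨ lookup∘tabulate (personAt v) j ⟩
      personAt v j                          ≡⟨ p∘seat (personAt v j) ⟨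
      lookup p (seat (personAt v j))        ≡⟨ cong (lookup p) (lookup∘tabulate seat (personAt v j)) ⟨
      lookup p (lookup v (personAt v j))    ≡⟨ cong (lookup p) (lookup-personAt v seating j) ⟩
      lookup p j                            ∎ })
  (HasCardinality-image permutation permutation-injective (seating-cardinality m))
  where open ≡-Reasoning
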